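{- Let $\mathcal{H}=\{rrr,bbr,yyr\}$. Then $h_2(n,\mathcal{H})=\lceil n/2\rceil$.
   Context: Here $n$ denotes the number of vertices of the complete graph $K_n$. Edge-colorings of $K_n$ use colors from $\{r,b,y\}$ (red, blue, yellow); they need not be proper, and not all colors need be used. A pattern is an edge-colored triangle, denoted by the multiset of the colors of its three edges; e.g. $rrr$ is the all-red triangle, $bbr$ is the triangle with two blue edges and one red edge, and $yyr$ has two yellow edges and one red edge. For a family $\mathcal{H}$ of patterns, $\operatorname{Forb}(n,\mathcal{H})$ is the set of all edge-colorings of $K_n$ with colors from $\{r,b,y\}$ in which no triangle has a coloring belonging to $\mathcal{H}$. For an edge-coloring $c$ of $K_n$, $h_2(c)$ is the maximum $k$ such that there is a set of $k$ vertices whose induced edges use at most two of the three colors. Finally, $h_2(n,\mathcal{H})=\min\{h_2(c): c\in\operatorname{Forb}(n,\mathcal{H})\}$.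
   Formalization: The case n = 2 is excluded, since the claim fails there: K_2 has a single edge, so h_2 of every coloring is 2, whereas ⌈2/2⌉ = 1; all other n are covered. -}

module Defs where

open import Data.Fin using (Fin)
open import Data.Fin.Subset using (Subset; _∈_; ∣_∣)
open import Data.List using (List; []; _∷_)
open import Data.List.Relation.Unary.Any using (Any)
open import Data.List.Relation.Binary.Permutation.Propositional using (_↭_)
open import Data.Nat using (ℕ; _≤_)
open import Data.Product using (Σ; ∃; _×_; proj₁)
open import Data.Sum using (_⊎_)
open import Data.Vec using (Vec; []; _∷_; toList)
open import Level using (0ℓ)
open import Relation.Binary.PropositionalEquality using (_≡_; _≢_)
open import Relation.Nullary using (¬_)
open import Relation.Unary using (Pred)

data Colour : Set where
  red blue yellow : Colour

-- The vertices of Kₙ are Fin n.  The diagonal values colour i i carry no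
-- meaning: every definition below looks only at pairs of distinct vertices.
record Colouring (n : ℕ) : Set where
  field
    colour    : Fin n → Fin n → Colour
    symmetric : ∀ i j → colour i j ≡ colour j i

open Colouring public

-- A multiset of three colours, represented by any of its orderings; patterns
-- are only ever compared up to permutation.
Pattern : Set
Pattern = Vec Colour 3

_≈ᵖ_ : Pattern → Pattern → Set
p ≈ᵖ q = toList p ↭ toList q

trianglePattern : ∀ {n} → Colouring n → (i j k : Fin n) → Pattern
trianglePattern c i j k = colour c i j ∷ colour c j k ∷ colour c i k ∷ []

Avoids : ∀ {n} → List Pattern → Colouring n → Set
Avoids 𝓗 c = ∀ i j k → i ≢ j → j ≢ k → i ≢ k →
  ¬ Any (trianglePattern c i j k ≈ᵖ_) 𝓗

Forb : ℕ → List Pattern → Set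
Forb n 𝓗 = Σ (Colouring n) (Avoids 𝓗)

-- The two colours may coincide, and neither has to occur.
AtMostTwoColours : ∀ {n} → Colouring n → Subset n → Set
AtMostTwoColours c S = ∃ λ x → ∃ λ x′ →
  ∀ i j → i ∈ S → j ∈ S → i ≢ j → colour c i j ≡ x ⊎ colour c i j ≡ x′

IsMaximum : Pred ℕ 0ℓ → ℕ → Set
IsMaximum P m = P m × (∀ k → P k → k ≤ m)

IsMinimum : Pred ℕ 0ℓ → ℕ → Set
IsMinimum P m = P m × (∀ k → P k → m ≤ k)

-- h₂(c) and h₂(n, 𝓗) are given by their graphs:  h₂[ c ]≡ m  says that m is
-- the value of h₂(c), and  h₂[ n , 𝓗 ]≡ m  that m is the value of h₂(n, 𝓗).
h₂[_]≡_ : ∀ {n} → Colouring n → ℕ → Set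
h₂[ c ]≡ m = IsMaximum (λ k → ∃ λ S → ∣ S ∣ ≡ k × AtMostTwoColours c S) m

h₂[_,_]≡_ : (n : ℕ) → List Pattern → ℕ → Set
h₂[ n , 𝓗 ]≡ m = IsMinimum (λ k → Σ (Forb n 𝓗) λ c → h₂[ proj₁ c ]≡ k) m

rrr,bbr,yyr : List Pattern
rrr,bbr,yyr =
  (red    ∷ red    ∷ red ∷ []) ∷
  (blue   ∷ blue   ∷ red ∷ []) ∷
  (yellow ∷ yellow ∷ red ∷ []) ∷ []

{-# OPTIONS --safe #-}
-- Lower bound: the red graph of a colouring in Forb(n, 𝓗) is bipartite, so one
-- of its two sides has at least ⌈n/2⌉ vertices and carries no red edge.
-- Give the diagonal the colour blue.  Then, for a red edge uv and any vertex w,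
-- the colours of wu and wv differ, so a red walk p seen from w is a walk in the
-- triangle on {r, b, y}; let its winding from w be the signed number of steps.
-- The grid p × p is mapped to that triangle, and a closed 4-walk in a triangle
-- has winding 0.  Pushing the diagonal of the grid, which reads b, r, b, r, …,
-- to its border shows that twice the winding of a closed walk is 0; but the
-- winding of a walk of odd length is odd.
--
-- Upper bound: make the edges {2i, 2i+1} red, and any other edge blue or yellow
-- according to whether its ends have the same parity.  The ends of a red edge
-- and a third vertex span all three colours, so a two-coloured set with more
-- than two vertices contains at most one end of each red edge.
module Submission where

open import Data.Bool using (Bool; true; false; not; _xor_)
open import Data.Bool.Properties using (not-¬; ¬-not; xor-assoc; xor-comm; xor-same)
open import Data.Empty using (⊥; ⊥-elim)
open import Data.Fin using (Fin; zero; suc; toℕ)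
open import Data.Fin.Properties using (toℕ-injective) renaming (_≟_ to _≟ᶠ_)
open import Data.Fin.Subset using (Subset; inside; outside; _∈_; _∪_; ⁅_⁆; ∁; ∣_∣)
open import Data.Fin.Subset.Properties
  using (∣p∣≤n; p⊆q⇒∣p∣≤∣q∣; ∣⁅x⁆∣≡1; x∈⁅x⁆; x∈p∪q⁺; x∈∁p⇒x∉p; ∣∁p∣≡n∸∣p∣)
open import Data.Integer using (ℤ; 0ℤ; 1ℤ; -1ℤ)
  renaming (∣_∣ to ∣_∣ᶻ; +_ to pos; _+_ to _+ᶻ_; _*_ to _*ᶻ_)
import Data.Integer.Properties as ℤₚ
import Data.Integer.Tactic.RingSolver as ℤ-Solver
open import Data.List using (List; []; _∷_; allFin; cartesianProduct)
open import Data.List.Membership.Propositional using () renaming (_∈_ to _∈ₗ_)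
open import Data.List.Membership.Propositional.Properties using (∈-cartesianProduct⁺; ∈-allFin)
open import Data.List.Relation.Binary.Permutation.Propositional
  using (_↭_; swap; prep; ↭-refl; ↭-sym)
open import Data.List.Relation.Binary.Permutation.Propositional.Properties using (∈-resp-↭)
open import Data.List.Relation.Unary.All as All using (All; []; _∷_)
open import Data.List.Relation.Unary.Any using (Any; here; there)
open import Data.Nat using (ℕ; suc; _+_; _*_; _≤_; z≤n; s≤s; ⌊_/2⌋; ⌈_/2⌉; parity)
import Data.Nat.Properties as ℕₚ
open import Data.Parity.Base using (0ℙ; 1ℙ)
import Data.Parity.Properties as ℙₚ
-- With _,_ in scope, h₂[ n , 𝓗 ]≡ m would also parse as h₂[ (n , 𝓗) ]≡ m, so
-- the constructor is only opened locally.
open import Data.Product using (Σ; ∃; _×_; proj₁; proj₂)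
open import Data.Sum using (_⊎_; inj₁; inj₂; fromInj₂)
open import Data.Vec using ([]; _∷_; here; there; tabulate; toList)
open import Data.Vec.Properties using ([]=⇒lookup; lookup⇒[]=; lookup∘tabulate)
open import Function using (_∘_)
open import Level using (0ℓ)
open import Relation.Binary using (Rel; DecidableEquality; Decidable)
open import Relation.Binary.PropositionalEquality
  using (_≡_; _≢_; refl; sym; trans; cong; cong₂; subst; ≢-sym; module ≡-Reasoning)
open import Relation.Nullary using (¬_; Dec; yes; no; contradiction; ¬?; _→-dec_; _×-dec_)
open import Relation.Nullary.Decidable using (map′; from-yes)
open import Relation.Unary using (Pred)
import Relation.Unary as U
open import Defs

-- Signed steps around the triangle of colours

module Steps where

  open import Data.Product using (_,_)

  _≟ᶜ_ : DecidableEquality Colour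
  red    ≟ᶜ red    = yes refl
  red    ≟ᶜ blue   = no λ ()
  red    ≟ᶜ yellow = no λ ()
  blue   ≟ᶜ red    = no λ ()
  blue   ≟ᶜ blue   = yes refl
  blue   ≟ᶜ yellow = no λ ()
  yellow ≟ᶜ red    = no λ ()
  yellow ≟ᶜ blue   = no λ ()
  yellow ≟ᶜ yellow = yes refl

  ∀ᶜ? : {P : Pred Colour 0ℓ} → U.Decidable P → Dec (∀ x → P x)
  ∀ᶜ? P? = map′ (λ { (r , b , y) → λ { red → r ; blue → b ; yellow → y } })
                (λ f → f red , f blue , f yellow)
                (P? red ×-dec P? blue ×-dec P? yellow)

  step : Colour → Colour → ℤ
  step red    red    = 0ℤ
  step red    blue   = 1ℤ
  step red    yellow = -1ℤ
  step blue   red    = -1ℤ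
  step blue   blue   = 0ℤ
  step blue   yellow = 1ℤ
  step yellow red    = 1ℤ
  step yellow blue   = -1ℤ
  step yellow yellow = 0ℤ

  step-cancel : ∀ x y → step x y +ᶻ step y x ≡ 0ℤ
  step-cancel = from-yes (∀ᶜ? λ x → ∀ᶜ? λ y → step x y +ᶻ step y x ℤₚ.≟ 0ℤ)

  step-±1 : ∀ x y → x ≢ y → step x y ≡ 1ℤ ⊎ step x y ≡ -1ℤ
  step-±1 red    red    x≢y = contradiction refl x≢y
  step-±1 red    blue   _   = inj₁ refl
  step-±1 red    yellow _   = inj₂ refl
  step-±1 blue   red    _   = inj₂ refl
  step-±1 blue   blue   x≢y = contradiction refl x≢y
  step-±1 blue   yellow _   = inj₁ refl
  step-±1 yellow red    _   = inj₁ refl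
  step-±1 yellow blue   _   = inj₂ refl
  step-±1 yellow yellow x≢y = contradiction refl x≢y

  -- Two nonzero steps sum to -2, 0 or 2. These are distinct modulo 3, so the difference of `z` and
  -- `w` modulo 3 already determines the sum.
  step-square : ∀ w x y z → w ≢ x → x ≢ z → w ≢ y → y ≢ z →
    step w x +ᶻ step x z ≡ step w y +ᶻ step y z
  step-square = from-yes (∀ᶜ? λ w → ∀ᶜ? λ x → ∀ᶜ? λ y → ∀ᶜ? λ z →
    ¬? (w ≟ᶜ x) →-dec ¬? (x ≟ᶜ z) →-dec ¬? (w ≟ᶜ y) →-dec ¬? (y ≟ᶜ z) →-dec
    (step w x +ᶻ step x z ℤₚ.≟ step w y +ᶻ step y z))

open Steps

-- Walks indexed by the parity of their length

data Walk {V : Set} (E : Rel V 0ℓ) : Bool → V → V → Set where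
  []  : ∀ {u} → Walk E false u u
  _∷_ : ∀ {b u v w} → E u v → Walk E b v w → Walk E (not b) u w

module _ {V : Set} {E : Rel V 0ℓ} where

  infixr 5 _++_
  _++_ : ∀ {a b u v w} → Walk E a u v → Walk E b v w → Walk E (a xor b) u w
  [] ++ q = q
  _++_ {b = b} {u} {w = w} (_∷_ {b = a} e p) q =
    subst (λ c → Walk E c u w) (not-xor a b) (e ∷ (p ++ q))
    where
    not-xor : ∀ a b → not (a xor b) ≡ not a xor b
    not-xor true  true  = refl
    not-xor true  false = refl
    not-xor false _     = refl

  reverse : (∀ {u v} → E u v → E v u) → ∀ {b u v} → Walk E b u v → Walk E b v u
  reverse symm [] = []
  reverse symm {u = u} {v} (_∷_ {b = b} e p) =
    subst (λ c → Walk E c v u) (xor-comm b true) (reverse symm p ++ symm e ∷ [])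

-- Winding of red walks and absence of odd closed walks

module Winding
  {V : Set} {E : Rel V 0ℓ} (col : V → V → Colour)
  (col-sym  : ∀ u v → col u v ≡ col v u)
  (col-diag : ∀ u v → col u u ≡ col v v)
  (col-edge : ∀ w {u v} → E u v → col w u ≢ col w v)
  where

  open import Data.Product using (_,_)

  winding : V → ∀ {b u v} → Walk E b u v → ℤ
  winding w []                        = 0ℤ
  winding w (_∷_ {u = u} {v = v} e p) = step (col w u) (col w v) +ᶻ winding w p

  -- Two adjacent rows of the grid form a ladder. Its rungs, like its rails, join distinct colours,
  -- so `step-square` pushes a rung across one square at a time.
  winding-shift : ∀ {b w x u v} → E w x → (p : Walk E b u v) →
    winding w p +ᶻ step (col w v) (col x v) ≡ step (col w u) (col x u) +ᶻ winding x p
  winding-shift {w = w} {x} {u} e [] =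
    ℤₚ.+-comm 0ℤ (step (col w u) (col x u))
  winding-shift {w = w} {x} {u} {v} e (_∷_ {v = t} f p) = begin
    (step (col w u) (col w t) +ᶻ winding w p) +ᶻ step (col w v) (col x v)
      ≡⟨ ℤₚ.+-assoc (step (col w u) (col w t)) (winding w p) _ ⟩
    step (col w u) (col w t) +ᶻ (winding w p +ᶻ step (col w v) (col x v))
      ≡⟨ cong (step (col w u) (col w t) +ᶻ_) (winding-shift e p) ⟩
    step (col w u) (col w t) +ᶻ (step (col w t) (col x t) +ᶻ winding x p)
      ≡⟨ ℤₚ.+-assoc (step (col w u) (col w t)) (step (col w t) (col x t)) _ ⟨
    (step (col w u) (col w t) +ᶻ step (col w t) (col x t)) +ᶻ winding x p
      ≡⟨ cong (_+ᶻ winding x p)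
           (step-square _ _ _ _ (col-edge w f) (transverse t) (transverse u) (col-edge x f)) ⟩
    (step (col w u) (col x u) +ᶻ step (col x u) (col x t)) +ᶻ winding x p
      ≡⟨ ℤₚ.+-assoc (step (col w u) (col x u)) (step (col x u) (col x t)) _ ⟩
    step (col w u) (col x u) +ᶻ (step (col x u) (col x t) +ᶻ winding x p) ∎
    where
    open ≡-Reasoning
    transverse : ∀ y → col w y ≢ col x y
    transverse y eq = col-edge y e (trans (col-sym y w) (trans eq (col-sym x y)))

  -- Peeling off the first edge moves the row of `u` to that of `t`. The leftover steps run from the
  -- diagonal at `u` to the diagonal at `t`, and cancel because the diagonal is constant. For a
  -- closed walk, twice the winding is 0.
  winding-ends : ∀ {b u v} (p : Walk E b u v) → winding u p +ᶻ winding v p ≡ 0ℤ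
  winding-ends [] = refl
  winding-ends {u = u} {v} (_∷_ {v = t} e p) = begin
    (α +ᶻ winding u p) +ᶻ (step (col v u) (col v t) +ᶻ winding v p)
      -- By symmetry, the first step seen from `v` is a rung at `v` between the rows of `u` and `t`.
      ≡⟨ cong (λ z → (α +ᶻ winding u p) +ᶻ (z +ᶻ winding v p))
           (cong₂ step (col-sym v u) (col-sym v t)) ⟩
    (α +ᶻ winding u p) +ᶻ (step (col u v) (col t v) +ᶻ winding v p)
      ≡⟨ regroup α (winding u p) _ (winding v p) ⟩
    α +ᶻ ((winding u p +ᶻ step (col u v) (col t v)) +ᶻ winding v p)
      ≡⟨ cong (λ z → α +ᶻ (z +ᶻ winding v p)) (winding-shift e p) ⟩
    α +ᶻ ((β +ᶻ winding t p) +ᶻ winding v p)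
      ≡⟨ regroup′ α β (winding t p) (winding v p) ⟩
    (α +ᶻ β) +ᶻ (winding t p +ᶻ winding v p)
      ≡⟨ cong₂ _+ᶻ_ diagonal (winding-ends p) ⟩
    0ℤ ∎
    where
    open ≡-Reasoning
    α = step (col u u) (col u t)
    β = step (col u t) (col t t)
    regroup : ∀ a b c d → (a +ᶻ b) +ᶻ (c +ᶻ d) ≡ a +ᶻ ((b +ᶻ c) +ᶻ d)
    regroup = ℤ-Solver.solve-∀
    regroup′ : ∀ a b c d → a +ᶻ ((b +ᶻ c) +ᶻ d) ≡ (a +ᶻ b) +ᶻ (c +ᶻ d)
    regroup′ = ℤ-Solver.solve-∀
    diagonal : α +ᶻ β ≡ 0ℤ
    diagonal = trans (cong (λ z → α +ᶻ step (col u t) z) (col-diag t u))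
                     (step-cancel (col u u) (col u t))

  bit : Bool → ℤ
  bit true  = 1ℤ
  bit false = 0ℤ

  -- Each edge contributes 1 or -1, so it flips the parity of the winding along with that of the
  -- length.
  winding-parity : ∀ w {b u v} (p : Walk E b u v) → ∃ λ k → winding w p ≡ pos 2 *ᶻ k +ᶻ bit b
  winding-parity w [] = 0ℤ , refl
  winding-parity w (_∷_ {b = b} e p)
    with winding w p | winding-parity w p | step-±1 _ _ (col-edge w e)
  ... | _ | k , refl | inj₁ eq rewrite eq = up b
    where
    up : ∀ b → ∃ λ l → 1ℤ +ᶻ (pos 2 *ᶻ k +ᶻ bit b) ≡ pos 2 *ᶻ l +ᶻ bit (not b)
    up false = k , identity k
      where
      identity : ∀ k → 1ℤ +ᶻ (pos 2 *ᶻ k +ᶻ 0ℤ) ≡ pos 2 *ᶻ k +ᶻ 1ℤ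
      identity = ℤ-Solver.solve-∀
    up true = k +ᶻ 1ℤ , identity k
      where
      identity : ∀ k → 1ℤ +ᶻ (pos 2 *ᶻ k +ᶻ 1ℤ) ≡ pos 2 *ᶻ (k +ᶻ 1ℤ) +ᶻ 0ℤ
      identity = ℤ-Solver.solve-∀
  ... | _ | k , refl | inj₂ eq rewrite eq = down b
    where
    down : ∀ b → ∃ λ l → -1ℤ +ᶻ (pos 2 *ᶻ k +ᶻ bit b) ≡ pos 2 *ᶻ l +ᶻ bit (not b)
    down false = k +ᶻ -1ℤ , identity k
      where
      identity : ∀ k → -1ℤ +ᶻ (pos 2 *ᶻ k +ᶻ 0ℤ) ≡ pos 2 *ᶻ (k +ᶻ -1ℤ) +ᶻ 1ℤ
      identity = ℤ-Solver.solve-∀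
    down true = k , identity k
      where
      identity : ∀ k → -1ℤ +ᶻ (pos 2 *ᶻ k +ᶻ 1ℤ) ≡ pos 2 *ᶻ k +ᶻ 0ℤ
      identity = ℤ-Solver.solve-∀

  no-odd-closed-walk : ∀ {u} → ¬ Walk E true u u
  no-odd-closed-walk {u} p with winding u p | winding-ends p | winding-parity u p
  -- The winding 2k + 1 vanishes, so 2k = -1; absolute values turn this into an even natural number
  -- equal to 1.
  ... | _ | s+s≡0 | k , refl = ℕₚ.even≢odd ∣ k ∣ᶻ 0 (begin
    2 * ∣ k ∣ᶻ       ≡⟨ ℤₚ.abs-* (pos 2) k ⟨
    ∣ pos 2 *ᶻ k ∣ᶻ  ≡⟨ cong ∣_∣ᶻ 2k≡-1 ⟩
    1                ∎)
    where
    open ≡-Reasoning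
    double : ∀ s → pos 2 *ᶻ s ≡ s +ᶻ s
    double = ℤ-Solver.solve-∀
    2k+1≡0 : pos 2 *ᶻ k +ᶻ 1ℤ ≡ 0ℤ
    2k+1≡0 = fromInj₂ (λ ())
      (ℤₚ.i*j≡0⇒i≡0∨j≡0 (pos 2) (trans (double _) s+s≡0))
    cancel : ∀ a → a ≡ (a +ᶻ 1ℤ) +ᶻ -1ℤ
    cancel = ℤ-Solver.solve-∀
    2k≡-1 : pos 2 *ᶻ k ≡ -1ℤ
    2k≡-1 = trans (cancel (pos 2 *ᶻ k)) (cong (_+ᶻ -1ℤ) 2k+1≡0)

-- Bipartiteness of graphs without odd closed walks

xor-involutive : ∀ s x → s xor (s xor x) ≡ x
xor-involutive s x = trans (sym (xor-assoc s s x)) (cong (_xor x) (xor-same s))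

xor-cancelˡ : ∀ s {x y} → s xor x ≡ s xor y → x ≡ y
xor-cancelˡ s {x} {y} eq =
  trans (sym (xor-involutive s x)) (trans (cong (s xor_) eq) (xor-involutive s y))

module Bipartition
  {V : Set} (_≟_ : DecidableEquality V)
  {E : Rel V 0ℓ} (E? : Decidable E)
  (E-sym : ∀ {u v} → E u v → E v u)
  (no-odd : ∀ {u} → ¬ Walk E true u u)
  (vertices : List V) (complete : ∀ v → v ∈ₗ vertices)
  where

  open import Data.Product using (_,_)

  -- A partition into connected blocks named by their roots. No tree is stored: a walk to the root
  -- certifies each side as its parity.
  record Forest : Set where
    field
      root   : V → V
      side   : V → Bool
      toRoot : ∀ v → Walk E (side v) v (root v)

  open Forest

  Split : Forest → V × V → Set
  Split F (u , v) = root F u ≡ root F v × side F u ≢ side F v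

  Respects : Forest → V × V → Set
  Respects F (u , v) = E u v → Split F (u , v)

  module Link (F : Forest) {u v : V} (e : E u v) (u≁v : root F u ≢ root F v) where

    -- Merging the block of `u` into that of `v`: each vertex of the former extends its walk by this
    -- one.
    bridge : Walk E (side F u xor not (side F v)) (root F u) (root F v)
    bridge = reverse E-sym (toRoot F u) ++ e ∷ toRoot F v

    relink : ∀ x → Dec (root F x ≡ root F u) → Σ V λ r → Σ Bool λ b → Walk E b x r
    relink x (yes x∼u) =
      root F v , _ , toRoot F x ++ subst (λ r → Walk E _ r (root F v)) (sym x∼u) bridge
    relink x (no _)    = root F x , side F x , toRoot F x

    relinked : ∀ x → Σ V λ r → Σ Bool λ b → Walk E b x r
    relinked x = relink x (root F x ≟ root F u)

    linked : Forest
    linked .root   x = proj₁ (relinked x)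
    linked .side   x = proj₁ (proj₂ (relinked x))
    linked .toRoot x = proj₂ (proj₂ (relinked x))

    -- Vertices with a common root move together, and their sides change by the same bit `s`.
    linked-split : ∀ {p} → Split F p → Split linked p
    linked-split {x , y} (x∼y , x≢y) with root F x ≟ root F u | root F y ≟ root F u
    ... | yes _   | yes _   = refl , λ eq →
      x≢y (xor-cancelˡ s (trans (xor-comm s _) (trans eq (xor-comm _ s))))
      where s = side F u xor not (side F v)
    ... | yes x∼u | no y≁u  = contradiction (trans (sym x∼y) x∼u) y≁u
    ... | no x≁u  | yes y∼u = contradiction (trans x∼y y∼u) x≁u
    ... | no _    | no _    = x∼y , x≢y

    linked-new : Split linked (u , v)
    linked-new with root F u ≟ root F u | root F v ≟ root F u
    ... | no u≁u | _       = contradiction refl u≁u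
    ... | _      | yes v∼u = contradiction (sym v∼u) u≁v
    -- The new side of `u` is `side F u xor (side F u xor not (side F
    -- v))`, the opposite of the unchanged side of `v`.
    ... | yes _  | no _    = refl , λ eq →
      not-¬ refl (trans (sym eq) (xor-involutive (side F u) (not (side F v))))

  -- With equal sides, the edge, the walk from `v` to the common root and the walk back to `u` would
  -- close up with odd length.
  split-edge : (F : Forest) → ∀ {u v} → E u v → root F u ≡ root F v → Split F (u , v)
  split-edge F {u} {v} e u∼v = u∼v , λ s≡t → no-odd (subst (λ b → Walk E b u u) (odd s≡t)
    (e ∷ toRoot F v ++ subst (λ r → Walk E _ r u) u∼v (reverse E-sym (toRoot F u))))
    where
    odd : ∀ {s t} → s ≡ t → not (t xor s) ≡ true
    odd {s} refl = cong not (xor-same s)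

  -- As in Kruskal's algorithm: an edge between two blocks merges them, an edge inside a block is
  -- handled by `split-edge`, and earlier pairs survive a merge by `linked-split`.
  forest : (ps : List (V × V)) → Σ Forest λ F → All (Respects F) ps
  forest [] = record { root = λ v → v ; side = λ _ → false ; toRoot = λ _ → [] } , []
  forest ((u , v) ∷ ps) with forest ps
  ... | F , resp with E? u v
  ... | no ¬e = F , (λ e → contradiction e ¬e) ∷ resp
  ... | yes e with root F u ≟ root F v
  ...   | yes u∼v = F , (λ _ → split-edge F e u∼v) ∷ resp
  ...   | no u≁v  = linked , (λ _ → linked-new) ∷ All.map (λ {p} r f → linked-split {p} (r f)) resp
    where open Link F e u≁v

  bipartite : Σ (V → Bool) λ σ → ∀ {u v} → E u v → σ u ≢ σ v
  bipartite with F , resp ← forest (cartesianProduct vertices vertices) =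
    side F , λ {u} {v} e → proj₂ (All.lookup resp (∈-cartesianProduct⁺ (complete u) (complete v)) e)

-- Lower bound: a red-free half of the vertices

module LowerBound {n : ℕ} (c : Colouring n) (avoids : Avoids rrr,bbr,yyr c) where

  open import Data.Product using (_,_)

  Red : Rel (Fin n) 0ℓ
  Red u v = u ≢ v × colour c u v ≡ red

  red? : Decidable Red
  red? u v = ¬? (u ≟ᶠ v) ×-dec (colour c u v ≟ᶜ red)

  red-sym : ∀ {u v} → Red u v → Red v u
  red-sym (u≢v , uv) = ≢-sym u≢v , trans (symmetric c _ _) uv

  blueDiagonal : ∀ {u v : Fin n} → Dec (u ≡ v) → Colour
  blueDiagonal         (yes _) = blue
  blueDiagonal {u} {v} (no _)  = colour c u v

  col : Fin n → Fin n → Colour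
  col u v = blueDiagonal (u ≟ᶠ v)

  col-sym : ∀ u v → col u v ≡ col v u
  col-sym u v with u ≟ᶠ v | v ≟ᶠ u
  ... | yes _   | yes _   = refl
  ... | yes u≡v | no v≢u  = contradiction (sym u≡v) v≢u
  ... | no u≢v  | yes v≡u = contradiction (sym v≡u) u≢v
  ... | no _    | no _    = symmetric c u v

  col-diag : ∀ u v → col u u ≡ col v v
  col-diag u v with u ≟ᶠ u | v ≟ᶠ v
  ... | yes _  | yes _  = refl
  ... | no u≢u | _      = contradiction refl u≢u
  ... | _      | no v≢v = contradiction refl v≢v

  -- The forbidden patterns are exactly a red edge together with two edges of one colour, for each
  -- of the three colours.
  no-isosceles : ∀ {u v w} → Red u v → w ≢ u → w ≢ v → colour c w u ≢ colour c w v
  no-isosceles {u} {v} {w} (u≢v , uv) w≢u w≢v eq =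
    avoids w u v w≢u u≢v w≢v (forbidden (colour c w u) (sym eq) uv)
    where
    forbidden : ∀ x {y z} → y ≡ x → z ≡ red → Any ((x ∷ z ∷ y ∷ []) ≈ᵖ_) rrr,bbr,yyr
    forbidden red    refl refl = here ↭-refl
    forbidden blue   refl refl = there (here (prep blue (swap red blue ↭-refl)))
    forbidden yellow refl refl = there (there (here (prep yellow (swap red yellow ↭-refl))))

  -- If `w` is an end of the edge, one colour is the blue of the diagonal and the other is red;
  -- otherwise `no-isosceles` applies.
  col-edge : ∀ w {u v} → Red u v → col w u ≢ col w v
  col-edge w {u} {v} e@(u≢v , uv) with w ≟ᶠ u | w ≟ᶠ v
  ... | yes w≡u  | yes w≡v  = contradiction (trans (sym w≡u) w≡v) u≢v
  ... | yes refl | no _     = λ eq → contradiction (trans eq uv) λ ()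
  ... | no _     | yes refl = λ eq → contradiction (trans (sym eq) (trans (symmetric c w u) uv)) λ ()
  ... | no w≢u   | no w≢v   = no-isosceles e w≢u w≢v

  red-free : ∀ {S : Subset n} → (∀ {i j} → i ∈ S → j ∈ S → ¬ Red i j) → AtMostTwoColours c S
  red-free indep = blue , yellow , λ i j i∈S j∈S i≢j →
    nonred (colour c i j) (λ ij → indep i∈S j∈S (i≢j , ij))
    where
    nonred : ∀ x → x ≢ red → x ≡ blue ⊎ x ≡ yellow
    nonred red    x≢red = contradiction refl x≢red
    nonred blue   _     = inj₁ refl
    nonred yellow _     = inj₂ refl

  large-two-coloured : ∃ λ S → ⌈ n /2⌉ ≤ ∣ S ∣ × AtMostTwoColours c S
  large-two-coloured
    with side , proper ← Bipartition.bipartite _≟ᶠ_ red? red-sym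
      (Winding.no-odd-closed-walk col col-sym col-diag col-edge) (allFin n) ∈-allFin
    = larger (ℕₚ.≤-total ∣ S ∣ ∣ ∁ S ∣)
    where
    S : Subset n
    S = tabulate side

    side-∈ : ∀ {i} → i ∈ S → side i ≡ true
    side-∈ {i} i∈S = trans (sym (lookup∘tabulate side i)) ([]=⇒lookup i∈S)

    side-∉ : ∀ {i} → i ∈ ∁ S → side i ≡ false
    side-∉ {i} i∈∁S = ¬-not λ i-true →
      x∈∁p⇒x∉p i∈∁S (lookup⇒[]= i S (trans (lookup∘tabulate side i) i-true))

    half≤ : ∀ {k l} → l ≤ k → k + l ≡ n → ⌈ n /2⌉ ≤ k
    half≤ {k} {l} l≤k refl = begin
      ⌈ k + l /2⌉  ≤⟨ ℕₚ.⌈n/2⌉-mono (ℕₚ.+-monoʳ-≤ k l≤k) ⟩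
      ⌈ k + k /2⌉  ≡⟨ ℕₚ.n≡⌈n+n/2⌉ k ⟨
      k            ∎
      where open ℕₚ.≤-Reasoning

    ∣S∣+∣∁S∣≡n : ∣ S ∣ + ∣ ∁ S ∣ ≡ n
    ∣S∣+∣∁S∣≡n = trans (cong (∣ S ∣ +_) (∣∁p∣≡n∸∣p∣ S)) (ℕₚ.m+[n∸m]≡n (∣p∣≤n S))

    larger : ∣ S ∣ ≤ ∣ ∁ S ∣ ⊎ ∣ ∁ S ∣ ≤ ∣ S ∣ → ∃ λ T → ⌈ n /2⌉ ≤ ∣ T ∣ × AtMostTwoColours c T
    larger (inj₁ le) = ∁ S , half≤ le (trans (ℕₚ.+-comm ∣ ∁ S ∣ ∣ S ∣) ∣S∣+∣∁S∣≡n) ,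
      red-free λ i∈ j∈ ij → proper ij (trans (side-∉ i∈) (sym (side-∉ j∈)))
    larger (inj₂ le) = S , half≤ le ∣S∣+∣∁S∣≡n ,
      red-free λ i∈ j∈ ij → proper ij (trans (side-∈ i∈) (sym (side-∈ j∈)))

-- Upper bound: the matching colouring

module UpperBound where

  open import Data.Product using (_,_)

  classify : ∀ {A B : Set} → Dec A → Dec B → Colour
  classify (yes _) _       = red
  classify (no _)  (yes _) = blue
  classify (no _)  (no _)  = yellow

  -- The half numbers the red edge and the parity selects its end; for odd `n` the last vertex stays
  -- unmatched.
  matchingColour : ℕ → ℕ → Colour
  matchingColour i j = classify (⌊ i /2⌋ ℕₚ.≟ ⌊ j /2⌋) (parity i ℙₚ.≟ parity j)

  matchingColour-sym : ∀ i j → matchingColour i j ≡ matchingColour j i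
  matchingColour-sym i j with ⌊ i /2⌋ ℕₚ.≟ ⌊ j /2⌋ | ⌊ j /2⌋ ℕₚ.≟ ⌊ i /2⌋
  ... | yes _  | yes _  = refl
  ... | yes eq | no neq = contradiction (sym eq) neq
  ... | no neq | yes eq = contradiction (sym eq) neq
  ... | no _   | no _   with parity i | parity j
  ...   | 0ℙ | 0ℙ = refl
  ...   | 0ℙ | 1ℙ = refl
  ...   | 1ℙ | 0ℙ = refl
  ...   | 1ℙ | 1ℙ = refl

  half-parity-injective : ∀ i j → ⌊ i /2⌋ ≡ ⌊ j /2⌋ → parity i ≡ parity j → i ≡ j
  half-parity-injective 0 0 _ _ = refl
  half-parity-injective 0 1 _ ()
  half-parity-injective 1 0 _ ()
  half-parity-injective 1 1 _ _ = refl
  half-parity-injective (suc (suc i)) (suc (suc j)) h p =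
    cong (λ k → suc (suc k)) (half-parity-injective i j (ℕₚ.suc-injective h) p)

  matchingColour-red⇒half : ∀ i j → matchingColour i j ≡ red → ⌊ i /2⌋ ≡ ⌊ j /2⌋
  matchingColour-red⇒half i j eq with ⌊ i /2⌋ ℕₚ.≟ ⌊ j /2⌋
  ... | yes h = h
  ... | no _ with parity i ℙₚ.≟ parity j
  matchingColour-red⇒half i j () | no _ | yes _
  matchingColour-red⇒half i j () | no _ | no _

  half⇒matchingColour-red : ∀ i j → ⌊ i /2⌋ ≡ ⌊ j /2⌋ → matchingColour i j ≡ red
  half⇒matchingColour-red i j h with ⌊ i /2⌋ ℕₚ.≟ ⌊ j /2⌋
  ... | yes _ = refl
  ... | no ¬h = contradiction h ¬h

  BlueYellow : Colour → Colour → Set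
  BlueYellow x y = (x ≡ blue × y ≡ yellow) ⊎ (x ≡ yellow × y ≡ blue)

  -- Only two numbers share a half, so `k` lies outside the pair. As `i` and `j` have opposite
  -- parities, `k` agrees with exactly one of them.
  matchingColour-rainbow : ∀ i j k → i ≢ j → j ≢ k → i ≢ k → ⌊ i /2⌋ ≡ ⌊ j /2⌋ →
    BlueYellow (matchingColour i k) (matchingColour j k)
  matchingColour-rainbow i j k i≢j j≢k i≢k h
    with ⌊ i /2⌋ ℕₚ.≟ ⌊ k /2⌋ | ⌊ j /2⌋ ℕₚ.≟ ⌊ k /2⌋
       | half-parity-injective i j h | half-parity-injective i k | half-parity-injective j k
  ... | yes a | no ¬b | _ | _ | _ = contradiction (trans (sym h) a) ¬b
  ... | no ¬a | yes b | _ | _ | _ = contradiction (trans h b) ¬a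
  ... | yes a | yes b | ij | ik | jk with parity i | parity j | parity k
  ...   | 0ℙ | 0ℙ | _  = contradiction (ij refl) i≢j
  ...   | 1ℙ | 1ℙ | _  = contradiction (ij refl) i≢j
  ...   | 0ℙ | 1ℙ | 0ℙ = contradiction (ik a refl) i≢k
  ...   | 0ℙ | 1ℙ | 1ℙ = contradiction (jk b refl) j≢k
  ...   | 1ℙ | 0ℙ | 0ℙ = contradiction (jk b refl) j≢k
  ...   | 1ℙ | 0ℙ | 1ℙ = contradiction (ik a refl) i≢k
  matchingColour-rainbow i j k i≢j _ _ h | no _ | no _ | ij | _ | _
    with parity i | parity j | parity k
  ...   | 0ℙ | 0ℙ | _  = contradiction (ij refl) i≢j
  ...   | 1ℙ | 1ℙ | _  = contradiction (ij refl) i≢j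
  ...   | 0ℙ | 1ℙ | 0ℙ = inj₁ (refl , refl)
  ...   | 0ℙ | 1ℙ | 1ℙ = inj₂ (refl , refl)
  ...   | 1ℙ | 0ℙ | 0ℙ = inj₂ (refl , refl)
  ...   | 1ℙ | 0ℙ | 1ℙ = inj₁ (refl , refl)

  matching : ∀ n → Colouring n
  matching n .colour i j    = matchingColour (toℕ i) (toℕ j)
  matching n .symmetric i j = matchingColour-sym (toℕ i) (toℕ j)

  module _ {n : ℕ} where

    matching-rainbow : ∀ (i j k : Fin n) → i ≢ j → j ≢ k → i ≢ k →
      ⌊ toℕ i /2⌋ ≡ ⌊ toℕ j /2⌋ → BlueYellow (colour (matching n) i k) (colour (matching n) j k)
    matching-rainbow i j k i≢j j≢k i≢k =
      matchingColour-rainbow _ _ _ (i≢j ∘ toℕ-injective) (j≢k ∘ toℕ-injective) (i≢k ∘ toℕ-injective)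

    -- Whichever edge is red, its ends are passed first to `matching-rainbow`. Membership is the
    -- right form since it is invariant under permutation of the pattern.
    matching-red⇒rainbow : ∀ i j k → i ≢ j → j ≢ k → i ≢ k →
      let T = toList (trianglePattern (matching n) i j k) in
      red ∈ₗ T → blue ∈ₗ T × yellow ∈ₗ T
    matching-red⇒rainbow i j k i≢j j≢k i≢k (here ij)
      with matching-rainbow i j k i≢j j≢k i≢k (matchingColour-red⇒half _ _ (sym ij))
    ... | inj₁ (ik , jk) = there (there (here (sym ik))) , there (here (sym jk))
    ... | inj₂ (ik , jk) = there (here (sym jk)) , there (there (here (sym ik)))
    matching-red⇒rainbow i j k i≢j j≢k i≢k (there (here jk))
      with matching-rainbow j k i j≢k (≢-sym i≢k) (≢-sym i≢j) (matchingColour-red⇒half _ _ (sym jk))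
         | symmetric (matching n) j i | symmetric (matching n) k i
    ... | inj₁ (ji , ki) | s | t =
      here (trans (sym ji) s) , there (there (here (trans (sym ki) t)))
    ... | inj₂ (ji , ki) | s | t =
      there (there (here (trans (sym ki) t))) , here (trans (sym ji) s)
    matching-red⇒rainbow i j k i≢j j≢k i≢k (there (there (here ik)))
      with matching-rainbow i k j i≢k (≢-sym j≢k) i≢j (matchingColour-red⇒half _ _ (sym ik))
         | symmetric (matching n) k j
    ... | inj₁ (ij , kj) | s = here (sym ij) , there (here (trans (sym kj) s))
    ... | inj₂ (ij , kj) | s = there (here (trans (sym kj) s)) , here (sym ij)

    -- Every forbidden pattern contains red but misses blue or yellow.
    matching-avoids : Avoids rrr,bbr,yyr (matching n)
    matching-avoids i j k i≢j j≢k i≢k = λ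
      { (here p)                 → absent p (here refl) λ { (there (there (there ())) , _) }
      ; (there (here p))         → absent p (there (there (here refl))) λ { (_ , there (there (there ()))) }
      ; (there (there (here p))) → absent p (there (there (here refl))) λ { (there (there (there ())) , _) }
      }
      where
      absent : ∀ {q} → toList (trianglePattern (matching n) i j k) ↭ q → red ∈ₗ q →
        ¬ ¬ (blue ∈ₗ q × yellow ∈ₗ q)
      absent p r∈q ¬by
        with b∈T , y∈T ← matching-red⇒rainbow i j k i≢j j≢k i≢k (∈-resp-↭ (↭-sym p) r∈q)
        = ¬by (∈-resp-↭ p b∈T , ∈-resp-↭ p y∈T)

    rainbow-third : ∀ {S} → AtMostTwoColours (matching n) S → ∀ {i j} → i ∈ S → j ∈ S → i ≢ j →
      ⌊ toℕ i /2⌋ ≡ ⌊ toℕ j /2⌋ → ∀ {k} → k ∈ S → k ≡ i ⊎ k ≡ j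
    rainbow-third (x , x′ , two) {i} {j} i∈S j∈S i≢j h {k} k∈S with k ≟ᶠ i | k ≟ᶠ j
    ... | yes k≡i | _       = inj₁ k≡i
    ... | no _    | yes k≡j = inj₂ k≡j
    ... | no k≢i  | no k≢j  = ⊥-elim
      (distinct (half⇒matchingColour-red _ _ h) (matching-rainbow i j k i≢j (≢-sym k≢j) (≢-sym k≢i) h)
        (two i j i∈S j∈S i≢j) (two i k i∈S k∈S (≢-sym k≢i)) (two j k j∈S k∈S (≢-sym k≢j)))
      where
      distinct : ∀ {a b c} → a ≡ red → BlueYellow b c →
        a ≡ x ⊎ a ≡ x′ → b ≡ x ⊎ b ≡ x′ → c ≡ x ⊎ c ≡ x′ → ⊥
      distinct refl (inj₁ (refl , refl)) (inj₁ refl) (inj₂ refl) (inj₁ ())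
      distinct refl (inj₁ (refl , refl)) (inj₁ refl) (inj₂ refl) (inj₂ ())
      distinct refl (inj₁ (refl , refl)) (inj₂ refl) (inj₁ refl) (inj₁ ())
      distinct refl (inj₁ (refl , refl)) (inj₂ refl) (inj₁ refl) (inj₂ ())
      distinct refl (inj₂ (refl , refl)) (inj₁ refl) (inj₂ refl) (inj₁ ())
      distinct refl (inj₂ (refl , refl)) (inj₁ refl) (inj₂ refl) (inj₂ ())
      distinct refl (inj₂ (refl , refl)) (inj₂ refl) (inj₁ refl) (inj₁ ())
      distinct refl (inj₂ (refl , refl)) (inj₂ refl) (inj₁ refl) (inj₂ ())

  ∣p∪q∣≤∣p∣+∣q∣ : ∀ {n} (p q : Subset n) → ∣ p ∪ q ∣ ≤ ∣ p ∣ + ∣ q ∣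
  ∣p∪q∣≤∣p∣+∣q∣ []            []            = z≤n
  ∣p∪q∣≤∣p∣+∣q∣ (outside ∷ p) (outside ∷ q) = ∣p∪q∣≤∣p∣+∣q∣ p q
  ∣p∪q∣≤∣p∣+∣q∣ (outside ∷ p) (inside  ∷ q) =
    subst (suc ∣ p ∪ q ∣ ≤_) (sym (ℕₚ.+-suc ∣ p ∣ ∣ q ∣)) (s≤s (∣p∪q∣≤∣p∣+∣q∣ p q))
  ∣p∪q∣≤∣p∣+∣q∣ (inside  ∷ p) (outside ∷ q) = s≤s (∣p∪q∣≤∣p∣+∣q∣ p q)
  ∣p∪q∣≤∣p∣+∣q∣ (inside  ∷ p) (inside  ∷ q) =
    s≤s (ℕₚ.≤-trans (∣p∪q∣≤∣p∣+∣q∣ p q) (ℕₚ.+-monoʳ-≤ ∣ p ∣ (ℕₚ.n≤1+n ∣ q ∣)))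

  ∣p∣≤2 : ∀ {n} {p : Subset n} i j → (∀ {k} → k ∈ p → k ≡ i ⊎ k ≡ j) → ∣ p ∣ ≤ 2
  ∣p∣≤2 {p = p} i j covers = begin
    ∣ p ∣                  ≤⟨ p⊆q⇒∣p∣≤∣q∣ (λ k∈p → x∈p∪q⁺ (locate (covers k∈p))) ⟩
    ∣ ⁅ i ⁆ ∪ ⁅ j ⁆ ∣      ≤⟨ ∣p∪q∣≤∣p∣+∣q∣ ⁅ i ⁆ ⁅ j ⁆ ⟩
    ∣ ⁅ i ⁆ ∣ + ∣ ⁅ j ⁆ ∣  ≡⟨ cong₂ _+_ (∣⁅x⁆∣≡1 i) (∣⁅x⁆∣≡1 j) ⟩
    2                      ∎
    where
    open ℕₚ.≤-Reasoning
    locate : ∀ {k} → k ≡ i ⊎ k ≡ j → k ∈ ⁅ i ⁆ ⊎ k ∈ ⁅ j ⁆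
    locate (inj₁ refl) = inj₁ (x∈⁅x⁆ i)
    locate (inj₂ refl) = inj₂ (x∈⁅x⁆ j)

  HalfPair : ∀ {n} → Subset n → Set
  HalfPair S = ∃ λ i → ∃ λ j → i ∈ S × j ∈ S × i ≢ j × ⌊ toℕ i /2⌋ ≡ ⌊ toℕ j /2⌋

  -- Vertices are removed two at a time, one red edge per round. Either both ends lie in `S`, or the
  -- round adds at most one to the size of `S` and exactly one to the bound.
  half-pigeonhole : ∀ {n} (S : Subset n) → HalfPair S ⊎ ∣ S ∣ ≤ ⌈ n /2⌉
  half-pigeonhole []                     = inj₂ z≤n
  -- The unmatched vertex for odd `n` accounts for the rounding up.
  half-pigeonhole S@(_ ∷ [])             = inj₂ (∣p∣≤n S)
  half-pigeonhole (x ∷ y ∷ S) with half-pigeonhole S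
  ... | inj₁ (i , j , i∈S , j∈S , i≢j , h) = inj₁
    (suc (suc i) , suc (suc j) , there (there i∈S) , there (there j∈S) ,
     (λ { refl → i≢j refl }) , cong suc h)
  half-pigeonhole (inside  ∷ inside  ∷ S) | inj₂ _  =
    inj₁ (zero , suc zero , here , there here , (λ ()) , refl)
  half-pigeonhole (inside  ∷ outside ∷ S) | inj₂ le = inj₂ (s≤s le)
  half-pigeonhole (outside ∷ inside  ∷ S) | inj₂ le = inj₂ (s≤s le)
  half-pigeonhole (outside ∷ outside ∷ S) | inj₂ le = inj₂ (ℕₚ.m≤n⇒m≤1+n le)

  matching-two-coloured≤ : ∀ {n} → n ≢ 2 → (S : Subset n) → AtMostTwoColours (matching n) S →
    ∣ S ∣ ≤ ⌈ n /2⌉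
  matching-two-coloured≤ {0} _ S _ = ∣p∣≤n S
  matching-two-coloured≤ {1} _ S _ = ∣p∣≤n S
  matching-two-coloured≤ {2} n≢2 _ _ = contradiction refl n≢2
  matching-two-coloured≤ {suc (suc (suc n))} _ S two with half-pigeonhole S
  ... | inj₂ le = le
  ... | inj₁ (i , j , i∈S , j∈S , i≢j , h) =
    -- No third vertex fits beside both ends of a red edge, and the bound is at least 2 because
    -- there are at least three vertices.
    ℕₚ.≤-trans (∣p∣≤2 i j (rainbow-third two i∈S j∈S i≢j h)) (s≤s (s≤s z≤n))

-- For two vertices every colouring uses a single colour, so the value is 2 and not 1; hence the
-- exclusion.
lemma3p21 : (n : ℕ) → n ≢ 2 → h₂[ n , rrr,bbr,yyr ]≡ ⌈ n /2⌉
lemma3p21 n n≢2 =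
  ((matching n , matching-avoids) , attained ,
    λ { _ (S , refl , two) → matching-two-coloured≤ n≢2 S two }) ,
  λ { k ((c , avoids) , _ , max) →
      let S , half≤∣S∣ , two = large-two-coloured c avoids
      in ℕₚ.≤-trans half≤∣S∣ (max ∣ S ∣ (S , refl , two)) }
  where
  open import Data.Product using (_,_)
  open LowerBound using (large-two-coloured)
  open UpperBound
  attained : ∃ λ S → ∣ S ∣ ≡ ⌈ n /2⌉ × AtMostTwoColours (matching n) S
  -- The lower bound applied to the matching colouring itself supplies a set, which the upper bound
  -- forces to have exactly this size.
  attained with S , half≤∣S∣ , two ← large-two-coloured (matching n) matching-avoids =
    S , ℕₚ.≤-antisym (matching-two-coloured≤ n≢2 S two) half≤∣S∣ , two
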